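{- For any tree $T$ with $\ell$ leaves and any vertex $x \in V(T)$ we have \[ p_x(T) = \begin{cases} \ell - 1, & \text{if } x \text{ is a leaf,} \\ \ell, & \text{otherwise.} \end{cases} \]
   Context: All graphs are finite, undirected and simple. A leaf is a vertex of degree one. A $u,v$-geodesic is a shortest $u,v$-path. For a vertex $x$ of a graph $G$, a set $S \subseteq V(G)$ is an $x$-position set if for every $y \in S$ no vertex of $S \setminus \{y\}$ lies on any $x,y$-geodesic in $G$. The $x$-position number $p_x(G)$ is the maximum cardinality of an $x$-position set of $G$.
   Formalization: The tree is assumed to have at least two vertices, because the claim fails for the one-vertex tree: it has no leaves, its vertex x is not a leaf, yet {x} is an x-position set, so p_x = 1 and not 0. -}

module Defs where

open import Data.Fin using (Fin)
import Data.Fin.Subset as Subset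
open import Data.Fin.Subset using (Subset; ∣_∣)
open import Data.List using (List; []; _∷_)
import Data.List.Membership.Propositional as List
open import Data.List.Relation.Unary.Unique.Propositional using (Unique)
open import Data.Nat using (ℕ; zero; suc; _≤_; _≟_)
open import Data.Product using (_×_; ∃; ∃₂; ∃-syntax)
open import Data.Vec using (tabulate)
open import Level using (0ℓ)
open import Relation.Binary using (Rel; Decidable; Symmetric; Irreflexive)
open import Relation.Binary.PropositionalEquality using (_≡_; _≢_)
open import Relation.Nullary using (¬_; Dec; does)

record Graph (n : ℕ) : Set₁ where
  field
    Adj    : Rel (Fin n) 0ℓ
    adj?   : Decidable Adj
    sym    : Symmetric Adj
    irrefl : Irreflexive _≡_ Adj

module _ {n : ℕ} (G : Graph n) where
  open Graph G

  neighbours : Fin n → Subset n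
  neighbours v = tabulate λ w → does (adj? v w)

  degree : Fin n → ℕ
  degree v = ∣ neighbours v ∣

  IsLeaf : Fin n → Set
  IsLeaf v = degree v ≡ 1

  isLeaf? : ∀ v → Dec (IsLeaf v)
  isLeaf? v = degree v ≟ 1

  leaves : Subset n
  leaves = tabulate λ v → does (isLeaf? v)

  data Walk : Fin n → Fin n → Set where
    []  : ∀ {u} → Walk u u
    _∷_ : ∀ {u v w} → Adj u v → Walk v w → Walk u w

module _ {n : ℕ} {G : Graph n} where

  length : ∀ {u v} → Walk G u v → ℕ
  length []      = zero
  length (_ ∷ p) = suc (length p)

  vertices : ∀ {u v} → Walk G u v → List (Fin n)
  vertices {u} []      = u ∷ []
  vertices {u} (_ ∷ p) = u ∷ vertices p

  IsPath : ∀ {u v} → Walk G u v → Set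
  IsPath p = Unique (vertices p)

  IsGeodesic : ∀ {u v} → Walk G u v → Set
  IsGeodesic {u} {v} p =
    IsPath p × ((q : Walk G u v) → IsPath q → length p ≤ length q)

module _ {n : ℕ} (G : Graph n) where
  open Graph G

  Connected : Set
  Connected = ∀ u v → ∃[ p ] IsPath {G = G} {u} {v} p

  -- A cycle is a path on at least three vertices together with an edge
  -- joining its last vertex to its first.
  HasCycle : Set
  HasCycle = ∃₂ λ u v → ∃[ p ] (IsPath {G = G} {u} {v} p × 2 ≤ length p × Adj v u)

  IsTree : Set
  IsTree = Connected × ¬ HasCycle

  -- Geodesics include their endpoints, so a position set containing x is the
  -- singleton of x when G is connected.
  IsPositionSet : Fin n → Subset n → Set
  IsPositionSet x S =
    ∀ {y z} → y Subset.∈ S → z Subset.∈ S → z ≢ y →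
    (p : Walk G x y) → IsGeodesic p → ¬ (z List.∈ vertices p)

  -- IsPositionNumber x k says that p_x(G) = k.
  IsPositionNumber : Fin n → ℕ → Set
  IsPositionNumber x k =
    (∃[ S ] (IsPositionSet x S × ∣ S ∣ ≡ k)) ×
    (∀ S → IsPositionSet x S → ∣ S ∣ ≤ k)

{-# OPTIONS --safe #-}
-- Root T at x. Every path ending in x extends backwards, one unused neighbour
-- at a time, until it starts at a leaf other than x. Sending y to a leaf reached
-- in this way is injective on an x-position set: by uniqueness of paths, two
-- vertices with the same leaf lie on one path to x, so one of them lies on the
-- geodesic between x and the other. Conversely the leaves other than x form an
-- x-position set, because inner vertices of a path have two neighbours.
module Submission where

open import Defs
open import Data.Fin using (Fin; zero; suc; _≟_)
open import Data.Fin.Properties using (any?; 0≢1+n; suc-injective)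
open import Data.Fin.Subset
  using (Subset; ∣_∣; inside; outside; ⁅_⁆; ⊤; _⊂_; _-_; _∈_; _∉_)
open import Data.Fin.Subset.Induction using (⊂-wellFounded)
open import Data.Fin.Subset.Properties
  using (x∈⁅x⁆; x∈⁅y⁆⇒x≡y; ∣⁅x⁆∣≡1; ⊆-antisym; p⊂q⇒∣p∣<∣q∣; p─⊥≡p;
         p─q⊆p; x∈p∧x≢y⇒x∈p-y; x∈p⇒∣p-x∣<∣p∣; x∈p⇒p-x⊂p; ∈⊤)
open import Data.List as List using ([]; _∷_; _∷ʳ_)
import Data.List.Membership.Propositional as List
import Data.List.Membership.DecPropositional as DecMembership
open import Data.List.Membership.Propositional.Properties using (∈-++⁻)
open import Data.List.Relation.Binary.Permutation.Propositional
  using (_↭_; refl; prep; trans; ↭⇒↭ₛ)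
open import Data.List.Relation.Binary.Permutation.Propositional.Properties
  using (∷↭∷ʳ; ∈-resp-↭)
open import Data.List.Relation.Binary.Permutation.Setoid.Properties using (Unique-resp-↭)
open import Data.List.Relation.Unary.All.Properties using (¬Any⇒All¬)
open import Data.List.Relation.Unary.AllPairs using ([]; _∷_)
open import Data.List.Relation.Unary.Any using (here; there)
open import Data.List.Relation.Unary.Unique.Propositional.Properties using (Unique[x∷xs]⇒x∉xs)
open import Data.Nat using (ℕ; suc; _≤_; _∸_; z≤n; s≤s)
open import Data.Nat.Properties using (≤-reflexive; ≤-trans; 1+n≰n)
  renaming (suc-injective to ℕ-suc-injective)
open import Data.Product using (_×_; _,_; ∃-syntax; Σ-syntax; proj₁; proj₂)
open import Data.Sum using (_⊎_; inj₁; inj₂; map₂)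
open import Data.Vec using ([]; _∷_; here; there; tabulate)
open import Data.Vec.Properties using (lookup∘tabulate; []=⇒lookup; lookup⇒[]=)
open import Function using (_∘_)
open import Induction.WellFounded using (Acc; acc)
open import Relation.Binary.PropositionalEquality as ≡
  using (_≡_; _≢_; refl; cong; subst; setoid)
open import Relation.Nullary using (¬_; Dec; yes; no; does; contradiction)
open import Relation.Nullary.Decidable using (dec-true; _×-dec_; ¬?)

-- Subsets of finite sets and their sizes.

module _ {n : ℕ} {P : Fin n → Set} (P? : ∀ i → Dec (P i)) where

  ∈-tabulate⁺ : ∀ {i} → P i → i ∈ tabulate (does ∘ P?)
  ∈-tabulate⁺ {i} Pi =
    lookup⇒[]= i _ (≡.trans (lookup∘tabulate (does ∘ P?) i) (dec-true (P? i) Pi))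

  ∈-tabulate⁻ : ∀ {i} → i ∈ tabulate (does ∘ P?) → P i
  ∈-tabulate⁻ {i} i∈ with P? i | ≡.trans (≡.sym (lookup∘tabulate (does ∘ P?) i)) ([]=⇒lookup i∈)
  ... | yes Pi | _ = Pi
  ... | no _   | ()

x∈p-y⇒x≢y : ∀ {n} (p : Subset n) {x y} → x ∈ p - y → x ≢ y
x∈p-y⇒x≢y (inside  ∷ p) {zero}  ()        refl
x∈p-y⇒x≢y (outside ∷ p) {zero}  ()        refl
x∈p-y⇒x≢y (_       ∷ p) {suc _} (there x∈) refl = x∈p-y⇒x≢y p x∈ refl

x∈p⇒∣p∣≡1+∣p-x∣ : ∀ {n} {p : Subset n} {x} → x ∈ p → ∣ p ∣ ≡ suc ∣ p - x ∣
x∈p⇒∣p∣≡1+∣p-x∣ {p = _ ∷ p}       here       = cong (suc ∘ ∣_∣) (≡.sym (p─⊥≡p p))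
x∈p⇒∣p∣≡1+∣p-x∣ {p = inside ∷ _}  (there x∈) = cong suc (x∈p⇒∣p∣≡1+∣p-x∣ x∈)
x∈p⇒∣p∣≡1+∣p-x∣ {p = outside ∷ _} (there x∈) = x∈p⇒∣p∣≡1+∣p-x∣ x∈

x∉p⇒p-x≡p : ∀ {n} {p : Subset n} {x} → x ∉ p → p - x ≡ p
x∉p⇒p-x≡p {p = p} {x} x∉p = ⊆-antisym (p─q⊆p p ⁅ x ⁆)
  λ y∈p → x∈p∧x≢y⇒x∈p-y y∈p λ { refl → x∉p y∈p }

injectiveOn⇒∣p∣≤∣q∣ : ∀ {m n} (p : Subset m) {q : Subset n} (f : Fin m → Fin n) →
  (∀ {i} → i ∈ p → f i ∈ q) → (∀ {i j} → i ∈ p → j ∈ p → f i ≡ f j → i ≡ j) →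
  ∣ p ∣ ≤ ∣ q ∣
injectiveOn⇒∣p∣≤∣q∣ []            f f∈ inj = z≤n
injectiveOn⇒∣p∣≤∣q∣ (outside ∷ p) f f∈ inj =
  injectiveOn⇒∣p∣≤∣q∣ p (f ∘ suc) (f∈ ∘ there)
    λ i∈ j∈ eq → suc-injective (inj (there i∈) (there j∈) eq)
injectiveOn⇒∣p∣≤∣q∣ (inside ∷ p) {q} f f∈ inj = ≤-trans
  -- Injectivity keeps the images of the remaining elements away from `f zero`, so they fit into the
  -- strictly smaller `q - f zero`.
  (s≤s (injectiveOn⇒∣p∣≤∣q∣ p {q - f zero} (f ∘ suc)
    (λ i∈ → x∈p∧x≢y⇒x∈p-y (f∈ (there i∈)) λ eq → 0≢1+n (inj here (there i∈) (≡.sym eq)))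
    λ i∈ j∈ eq → suc-injective (inj (there i∈) (there j∈) eq)))
  (x∈p⇒∣p-x∣<∣p∣ (f∈ here))

another : ∀ {n} → 2 ≤ n → (x : Fin n) → ∃[ z ] z ≢ x
another (s≤s (s≤s _)) zero    = suc zero , λ ()
another (s≤s (s≤s _)) (suc _) = zero , λ ()

-- Leaves, walks and paths in arbitrary graphs.

module _ {n : ℕ} {G : Graph n} where
  open Graph G

  leaf-unique-neighbour : ∀ {v a b} → IsLeaf G v → Adj v a → Adj v b → a ≡ b
  leaf-unique-neighbour {v} {a} {b} leaf va vb with a ≟ b
  ... | yes a≡b = a≡b
  ... | no  a≢b = contradiction
    (≤-trans (p⊂q⇒∣p∣<∣q∣ ⁅a⁆⊂N) (≤-reflexive (≡.trans leaf (≡.sym (∣⁅x⁆∣≡1 a))))) 1+n≰n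
    where
    ⁅a⁆⊂N : ⁅ a ⁆ ⊂ neighbours G v
    ⁅a⁆⊂N = (λ c∈ → ∈-tabulate⁺ (adj? v) (subst (Adj v) (≡.sym (x∈⁅y⁆⇒x≡y a c∈)) va))
          , b , ∈-tabulate⁺ (adj? v) vb , λ b∈ → a≢b (≡.sym (x∈⁅y⁆⇒x≡y a b∈))

  -- Without a second neighbour the neighbourhood would be the singleton of `a`, making `v` a leaf;
  -- the edge to `a` rules out degree zero.
  nonleaf-another-neighbour : ∀ {v a} → ¬ IsLeaf G v → Adj v a → ∃[ b ] (Adj v b × b ≢ a)
  nonleaf-another-neighbour {v} {a} ¬leaf va with any? (λ b → adj? v b ×-dec ¬? (b ≟ a))
  ... | yes found = found
  ... | no  none  = contradiction (≡.trans (cong ∣_∣ N≡⁅a⁆) (∣⁅x⁆∣≡1 a)) ¬leaf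
    where
    only-a : ∀ {b} → b ∈ neighbours G v → b ∈ ⁅ a ⁆
    only-a {b} b∈ with b ≟ a
    ... | yes refl = x∈⁅x⁆ a
    ... | no  b≢a  = contradiction (b , ∈-tabulate⁻ (adj? v) b∈ , b≢a) none
    N≡⁅a⁆ : neighbours G v ≡ ⁅ a ⁆
    N≡⁅a⁆ = ⊆-antisym only-a
      λ b∈ → ∈-tabulate⁺ (adj? v) (subst (Adj v) (≡.sym (x∈⁅y⁆⇒x≡y a b∈)) va)

  start∈ : ∀ {u v} (p : Walk G u v) → u List.∈ vertices p
  start∈ []      = here refl
  start∈ (_ ∷ _) = here refl

  end∈ : ∀ {u v} (p : Walk G u v) → v List.∈ vertices p
  end∈ []      = here refl
  end∈ (_ ∷ p) = there (end∈ p)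

  length-vertices : ∀ {u v} (p : Walk G u v) → List.length (vertices p) ≡ suc (length p)
  length-vertices []      = refl
  length-vertices (_ ∷ p) = cong suc (length-vertices p)

  ∷-isPath : ∀ {u v w} (e : Adj u v) (p : Walk G v w) →
    u List.∉ vertices p → IsPath p → IsPath (e ∷ p)
  ∷-isPath _ _ u∉p path = ¬Any⇒All¬ _ u∉p ∷ path

  path-tail : ∀ {u v w} (e : Adj u v) (p : Walk G v w) → IsPath (e ∷ p) → IsPath p
  path-tail _ _ (_ ∷ path) = path

  suffix : ∀ {u v y} (p : Walk G u v) → IsPath p → y List.∈ vertices p →
    Σ[ q ∈ Walk G y v ] (IsPath q × (∀ {z} → z List.∈ vertices q → z List.∈ vertices p))
  suffix []      path (here refl) = [] , path , λ z∈ → z∈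
  suffix (e ∷ p) path (here refl) = e ∷ p , path , λ z∈ → z∈
  suffix (e ∷ p) path (there y∈)  =
    let q , q-path , q⊆p = suffix p (path-tail e p path) y∈ in q , q-path , there ∘ q⊆p

  -- If `u` recurs on the shortened tail, only the suffix from that occurrence is kept. The
  -- inclusion of vertices ensures that whatever the walk avoids, the path avoids too.
  shorten : ∀ {u v} (p : Walk G u v) →
    Σ[ q ∈ Walk G u v ] (IsPath q × (∀ {z} → z List.∈ vertices q → z List.∈ vertices p))
  shorten [] = [] , ¬Any⇒All¬ [] (λ ()) ∷ [] , λ z∈ → z∈
  shorten {u} (e ∷ p) with shorten p
  ... | q , q-path , q⊆p with DecMembership._∈?_ _≟_ u (vertices q)
  ... | yes u∈q = let r , r-path , r⊆q = suffix q q-path u∈q in r , r-path , there ∘ q⊆p ∘ r⊆q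
  ... | no  u∉q = e ∷ q , ∷-isPath e q u∉q q-path ,
    λ { (here refl) → here refl ; (there z∈) → there (q⊆p z∈) }

  snoc : ∀ {u v w} → Walk G u v → Adj v w → Walk G u w
  snoc []      f = f ∷ []
  snoc (e ∷ p) f = e ∷ snoc p f

  vertices-snoc : ∀ {u v w} (p : Walk G u v) (e : Adj v w) →
    vertices (snoc p e) ≡ vertices p ∷ʳ w
  vertices-snoc []          e = refl
  vertices-snoc {u} (_ ∷ p) e = cong (u ∷_) (vertices-snoc p e)

  -- Traverses `p` and then `q` backwards, so that `reverse` is the case of an empty `p`.
  _++ʳ_ : ∀ {u v w} → Walk G u w → Walk G v w → Walk G u v
  p ++ʳ []      = p
  p ++ʳ (e ∷ q) = snoc (p ++ʳ q) (Graph.sym G e)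

  ∈-++ʳ⁻ : ∀ {u v w z} (p : Walk G u w) (q : Walk G v w) → z List.∈ vertices (p ++ʳ q) →
    z List.∈ vertices p ⊎ z List.∈ vertices q
  ∈-++ʳ⁻ p []      z∈ = inj₁ z∈
  ∈-++ʳ⁻ p (e ∷ q) z∈
    with ∈-++⁻ (vertices (p ++ʳ q))
               (subst (_ List.∈_) (vertices-snoc (p ++ʳ q) (Graph.sym G e)) z∈)
  ... | inj₁ z∈p++q      = map₂ there (∈-++ʳ⁻ p q z∈p++q)
  ... | inj₂ (here refl) = inj₂ (here refl)

  reverse : ∀ {u v} → Walk G u v → Walk G v u
  reverse p = [] ++ʳ p

  -- A permutation is enough: it transfers both uniqueness and membership to the reversed path.
  vertices-reverse : ∀ {u v} (p : Walk G u v) → vertices p ↭ vertices (reverse p)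
  vertices-reverse []      = refl
  vertices-reverse {u} (e ∷ p)
    rewrite vertices-snoc (reverse p) (Graph.sym G e) =
    trans (prep u (vertices-reverse p)) (∷↭∷ʳ u _)

  reverse-isPath : ∀ {u v} (p : Walk G u v) → IsPath p → IsPath (reverse p)
  reverse-isPath p = Unique-resp-↭ (setoid (Fin n)) (↭⇒↭ₛ (vertices-reverse p))

  -- The witnesses are the predecessor and the successor of `z`, distinct because a path repeats no
  -- vertex.
  inner-two-neighbours : ∀ {u v z} (p : Walk G u v) → IsPath p →
    z List.∈ vertices p → z ≢ u → z ≢ v → ∃[ a ] ∃[ b ] (Adj z a × Adj z b × a ≢ b)
  inner-two-neighbours []      path (here z≡u) z≢u z≢v = contradiction z≡u z≢u
  inner-two-neighbours (e ∷ p) path (here z≡u) z≢u z≢v = contradiction z≡u z≢u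
  inner-two-neighbours (e ∷ []) path (there (here z≡v)) z≢u z≢v = contradiction z≡v z≢v
  inner-two-neighbours {u} (e ∷ p@(_∷_ {v = w} f q)) path (there z∈) z≢u z≢v
    with z∈
  ... | here refl = u , w , Graph.sym G e , f ,
    λ { refl → Unique[x∷xs]⇒x∉xs path (there (start∈ q)) }
  ... | there z∈q = inner-two-neighbours p (path-tail e p path) z∈
    (λ { refl → Unique[x∷xs]⇒x∉xs (path-tail e p path) z∈q }) z≢v

  -- Whichever of `y` and `z` comes first on `p` starts a suffix that contains the other.
  comparable : ∀ {u x y z} (p : Walk G u x) → IsPath p →
    y List.∈ vertices p → z List.∈ vertices p →
    (Σ[ q ∈ Walk G y x ] (IsPath q × z List.∈ vertices q)) ⊎
    (Σ[ q ∈ Walk G z x ] (IsPath q × y List.∈ vertices q))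
  comparable p@[]      path (here refl) z∈          = inj₁ (p , path , z∈)
  comparable p@(_ ∷ _) path (here refl) z∈          = inj₁ (p , path , z∈)
  comparable p@(_ ∷ _) path y∈          (here refl) = inj₂ (p , path , y∈)
  comparable (e ∷ p)   path (there y∈)  (there z∈)  = comparable p (path-tail e p path) y∈ z∈

  leaves-minus-root-isPositionSet : ∀ x → IsPositionSet G x (leaves G - x)
  leaves-minus-root-isPositionSet x y∈ z∈ z≢y p (path , _) z∈p =
    let a , b , za , zb , a≢b = inner-two-neighbours p path z∈p (x∈p-y⇒x≢y (leaves G) z∈) z≢y
    in a≢b (leaf-unique-neighbour (∈-tabulate⁻ (isLeaf? G) (p─q⊆p (leaves G) ⁅ x ⁆ z∈)) za zb)

  -- Acyclic graphs: uniqueness of paths, extension to leaves, and the upper bound.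

  module _ (acyclic : ¬ HasCycle G) where

    -- Otherwise a path from a to b inside p followed by the reverse of q closes a
    -- cycle through u.
    neighbours-separated : ∀ {u a b w} → Adj u a → Adj u b →
      (p : Walk G a w) (q : Walk G b w) → u List.∉ vertices p → u List.∉ vertices q → a ≡ b
    neighbours-separated {u} {a} {b} ua ub p q u∉p u∉q with a ≟ b
    ... | yes a≡b = a≡b
    ... | no  a≢b with shorten (p ++ʳ q)
    ...   | []          , _    , _    = contradiction refl a≢b
    ...   | r@(_ ∷ _) , path , r⊆ = contradiction
      (u , b , ua ∷ r , ∷-isPath ua r u∉r path , s≤s (s≤s z≤n) , Graph.sym G ub) acyclic
      where
      u∉r : u List.∉ vertices r
      u∉r u∈r with ∈-++ʳ⁻ p q (r⊆ u∈r)
      ... | inj₁ u∈p = u∉p u∈p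
      ... | inj₂ u∈q = u∉q u∈q

    -- Both tails avoid `u` and end at the same vertex, so the first steps agree by
    -- `neighbours-separated`. Vertex lists are compared because proofs of adjacency may differ.
    path-unique : ∀ {u v} (p q : Walk G u v) → IsPath p → IsPath q → vertices p ≡ vertices q
    path-unique []      []      _ _ = refl
    path-unique []      (e ∷ q) _ Q = contradiction (end∈ q) (Unique[x∷xs]⇒x∉xs Q)
    path-unique (e ∷ p) []      P _ = contradiction (end∈ p) (Unique[x∷xs]⇒x∉xs P)
    path-unique {u} (e ∷ p) (f ∷ q) P Q
      with refl ← neighbours-separated e f p q (Unique[x∷xs]⇒x∉xs P) (Unique[x∷xs]⇒x∉xs Q) =
      cong (u ∷_) (path-unique p q (path-tail e p P) (path-tail f q Q))

    path⇒geodesic : ∀ {u v} (p : Walk G u v) → IsPath p → IsGeodesic p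
    path⇒geodesic p P = P , λ q Q → ≤-reflexive (ℕ-suc-injective
      (≡.trans (≡.sym (length-vertices p)) (≡.trans (cong List.length (path-unique p q P Q)) (length-vertices q))))

    -- In the tree rooted at `x`, this is a leaf among the descendants of `y`, with `y` itself
    -- included.
    LeafBeyond : Fin n → Fin n → Set
    LeafBeyond x y = ∃[ f ] (f ∈ leaves G - x ×
      Σ[ p ∈ Walk G f x ] (IsPath p × y List.∈ vertices p))

    extend-to-leaf : ∀ {x y v} (unused : Subset n) → Acc _⊂_ unused →
      (p : Walk G v x) → IsPath p → v ≢ x →
      (∀ {z} → z List.∉ vertices p → z ∈ unused) → y List.∈ vertices p → LeafBeyond x y
    extend-to-leaf unused _ [] _ v≢x _ _ = contradiction refl v≢x
    extend-to-leaf {v = v} unused (acc rec) p@(e ∷ q) path v≢x rest y∈p with isLeaf? G v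
    ... | yes leaf = v , x∈p∧x≢y⇒x∈p-y (∈-tabulate⁺ (isLeaf? G) leaf) v≢x , p , path , y∈p
    ... | no ¬leaf with nonleaf-another-neighbour ¬leaf e
    ...   | b , vb , b≢a =
      extend-to-leaf (unused - b) (rec (x∈p⇒p-x⊂p (rest b∉p))) (bv ∷ p) (∷-isPath bv p b∉p path)
        (λ { refl → b∉p (end∈ p) })
        (λ z∉ → x∈p∧x≢y⇒x∈p-y (rest (z∉ ∘ there)) (z∉ ∘ here))
        (there y∈p)
      where
      bv = Graph.sym G vb
      v∉q = Unique[x∷xs]⇒x∉xs path
      b∉p : b List.∉ vertices p
      b∉p (here b≡v)  = irrefl (≡.sym b≡v) vb
      -- The suffix of `q` from `b` and `q` itself both avoid `v` and end at `x`, which forces `b`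
      -- to be the next vertex `a` of the path.
      b∉p (there b∈q) =
        let r , _ , r⊆q = suffix q (path-tail e q path) b∈q
        in b≢a (neighbours-separated vb e r q (v∉q ∘ r⊆q) v∉q)

    leaf-beyond : 2 ≤ n → Connected G → ∀ x y → LeafBeyond x y
    leaf-beyond 2≤n connected x y with y ≟ x
    ... | no y≢x =
      let p , path = connected y x
      in extend-to-leaf ⊤ (⊂-wellFounded ⊤) p path y≢x (λ _ → ∈⊤) (start∈ p)
    -- The trivial path at `x` gives no edge to extend, so the path starts at some other vertex and
    -- has `x` as its end. A one-vertex tree has no leaf at all, whence `2 ≤ n`.
    ... | yes refl =
      let z , z≢x  = another 2≤n x
          p , path = connected z x
      in extend-to-leaf ⊤ (⊂-wellFounded ⊤) p path z≢x (λ _ → ∈⊤) (end∈ p)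

    -- Position sets speak of geodesics from `x`, so the path towards `x` is reversed; acyclicity
    -- makes it a geodesic.
    positionSet-antichain : ∀ {x S y z} → IsPositionSet G x S → y ∈ S → z ∈ S →
      (p : Walk G y x) → IsPath p → z List.∈ vertices p → z ≡ y
    positionSet-antichain {y = y} {z} pos y∈S z∈S p path z∈p with z ≟ y
    ... | yes z≡y = z≡y
    ... | no  z≢y = contradiction (∈-resp-↭ (vertices-reverse p) z∈p)
      (pos y∈S z∈S z≢y (reverse p) (path⇒geodesic (reverse p) (reverse-isPath p path)))

    positionSet-bound : 2 ≤ n → Connected G → ∀ x S → IsPositionSet G x S →
      ∣ S ∣ ≤ ∣ leaves G - x ∣
    positionSet-bound 2≤n connected x S pos =
      injectiveOn⇒∣p∣≤∣q∣ S (proj₁ ∘ beyond) (λ {y} _ → proj₁ (proj₂ (beyond y)))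
        λ {y} {z} y∈S z∈S → injective y∈S z∈S (proj₂ (proj₂ (beyond y))) (proj₂ (proj₂ (beyond z)))
      where
      beyond = leaf-beyond 2≤n connected x
      -- The leaves are variables here so that their equality can be matched with `refl`, giving
      -- both paths the same ends.
      injective : ∀ {y z f g} → y ∈ S → z ∈ S →
        Σ[ p ∈ Walk G f x ] (IsPath p × y List.∈ vertices p) →
        Σ[ q ∈ Walk G g x ] (IsPath q × z List.∈ vertices q) → f ≡ g → y ≡ z
      injective y∈S z∈S (p , P , y∈p) (q , Q , z∈q) refl
        -- Uniqueness of paths moves `z` from `q` onto `p`, where it can be compared with `y`.
        with comparable p P y∈p (subst (_ List.∈_) (path-unique q p Q P) z∈q)
      ... | inj₁ (r , R , z∈r) = ≡.sym (positionSet-antichain pos y∈S z∈S r R z∈r)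
      ... | inj₂ (r , R , y∈r) = positionSet-antichain pos z∈S y∈S r R y∈r

  -- Covers both cases of the theorem at once: deleting `x` changes the set of leaves exactly when
  -- `x` is a leaf.
  tree-positionNumber : 2 ≤ n → IsTree G → ∀ x → IsPositionNumber G x ∣ leaves G - x ∣
  tree-positionNumber 2≤n (connected , acyclic) x =
    (leaves G - x , leaves-minus-root-isPositionSet x , refl) , positionSet-bound acyclic 2≤n connected x

corollary3p6 : ∀ {n : ℕ} (T : Graph n) → 2 ≤ n → IsTree T → (x : Fin n) →
    (IsLeaf T x → IsPositionNumber T x (∣ leaves T ∣ ∸ 1)) ×
    (¬ IsLeaf T x → IsPositionNumber T x ∣ leaves T ∣)
corollary3p6 T 2≤n tree x =
    -- Here `x` itself is counted in `leaves T`, so the truncated subtraction is exact.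
    (λ leaf → subst (IsPositionNumber T x)
      (cong (_∸ 1) (≡.sym (x∈p⇒∣p∣≡1+∣p-x∣ (∈-tabulate⁺ (isLeaf? T) leaf)))) number)
  , (λ ¬leaf → subst (IsPositionNumber T x)
      (cong ∣_∣ (x∉p⇒p-x≡p (¬leaf ∘ ∈-tabulate⁻ (isLeaf? T)))) number)
  where number = tree-positionNumber 2≤n tree x
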